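{- For all finite subsets $A$ of $\mathbb{Z}_{>0}$, the chromatic polynomial of $\Gamma_A$ is $$\mathrm{ch}_{\Gamma_A}(t)=\sum_{k=1}^{|A|}s_D(A,k)\,t^k,$$ where $(-1)^{k}s_D(A,k)$ is equal to the number of D-permutations on $A$ with exactly $k$ cycles.
   Context: For a finite set $A\subset\mathbb{Z}_{>0}$, $\Gamma_A$ is the bipartite graph on vertex set $A$ with an edge $\{u,v\}$ for each $u<v$ in $A$ with $u$ odd and $v$ even. A permutation $\sigma$ of $A$ is a D-permutation on $A$ if $i\le\sigma(i)$ whenever $i\in A$ is odd and $i\ge\sigma(i)$ whenever $i\in A$ is even. Fixed points count as cycles.
   Formalization: The sign (-1)^k is corrected to (-1)^(|A|-k), since for odd |A| (e.g. A={1}, ch=t) the stated sign fails, and A is assumed nonempty, since for A=∅ the chromatic polynomial is 1 but the sum is 0. -}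

module Defs where

open import Data.Fin.Base using (Fin; toℕ)
open import Data.Fin.Properties using (_≟_; all?; any?; pigeonhole; toℕ<n; toℕ≤pred[n])
open import Data.Integer.Base as ℤ using (ℤ; +_; 0ℤ)
open import Data.List.Base as List
  using (List; []; _∷_; allFin; applyUpTo; cartesianProductWith; deduplicate; filter; foldr; length)
open import Data.List.Relation.Unary.All using (All)
open import Data.List.Relation.Unary.Linked using (Linked)
open import Data.Nat.Base using (ℕ; zero; suc; _+_; _∸_; _≤_; _<_; z≤n)
open import Data.Nat.Divisibility using (_∣_; _∤_; _∣?_)
open import Data.Nat.GeneralisedArithmetic using (fold; fold-+)
import Data.Nat.Properties as ℕ
open import Data.Product.Base using (∃-syntax; _×_; _,_; proj₁)
open import Data.Sum.Base using (_⊎_; [_,_]; swap)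
open import Data.Vec.Base as Vec using (Vec; lookup)
open import Function.Base using (_∘_)
open import Function.Definitions using (Injective; Surjective; Bijective)
open import Function.Consequences.Propositional
  using (strictlySurjective⇒surjective; surjective⇒strictlySurjective)
open import Level using (0ℓ)
open import Relation.Binary.Core using (Rel)
import Relation.Binary.Definitions as B
open import Relation.Binary.PropositionalEquality
  using (_≡_; _≢_; refl; trans; cong; subst; module ≡-Reasoning)
open import Relation.Nullary.Decidable using (Dec; yes; no; map′; ¬?; _×-dec_; _⊎-dec_; _→-dec_)
import Relation.Unary as U

-- A finite subset of ℤ_{>0}, given by its elements in increasing order.
record FiniteSubset : Set where
  field
    elements   : List ℕ
    increasing : Linked _<_ elements
    positive   : All (0 <_) elements

open FiniteSubset public

card : FiniteSubset → ℕ
card A = length (elements A)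

-- The position i : Fin (card A) stands for the element `element A i` of A;
-- graphs and permutations on A are expressed in terms of positions.
element : (A : FiniteSubset) → Fin (card A) → ℕ
element A = List.lookup (elements A)

Odd Even : ℕ → Set
Odd  n = 2 ∤ n
Even n = 2 ∣ n

odd? : U.Decidable Odd
odd? n = ¬? (2 ∣? n)

even? : U.Decidable Even
even? n = 2 ∣? n

-- Every vector over Fin m of length n occurs exactly once in this list, so
-- filtering it and taking the length counts the functions Fin n → Fin m
-- with a given property.
allVecs : ∀ m n → List (Vec (Fin m) n)
allVecs m zero    = Vec.[] ∷ []
allVecs m (suc n) = cartesianProductWith Vec._∷_ (allFin m) (allVecs m n)

count : ∀ {m n} {P : U.Pred (Vec (Fin m) n) 0ℓ} → U.Decidable P → ℕ
count {m} {n} P? = length (filter P? (allVecs m n))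

------------------------------------------------------------------------
-- Graphs and chromatic polynomials

record Graph (n : ℕ) : Set₁ where
  field
    Adjacent    : Rel (Fin n) 0ℓ
    symmetric   : B.Symmetric Adjacent
    irreflexive : B.Irreflexive _≡_ Adjacent
    adjacent?   : B.Decidable Adjacent

open Graph public

ProperColouring : ∀ {n t} → Graph n → Vec (Fin t) n → Set
ProperColouring G c = ∀ i j → Adjacent G i j → lookup c i ≢ lookup c j

properColouring? : ∀ {n t} (G : Graph n) → U.Decidable (ProperColouring {n} {t} G)
properColouring? G c =
  all? λ i → all? λ j → adjacent? G i j →-dec ¬? (lookup c i ≟ lookup c j)

#properColourings : ∀ {n} → Graph n → ℕ → ℕ
#properColourings {n} G t = count {t} {n} (properColouring? G)

-- Polynomials over ℤ: the coefficients of t⁰, t¹, t², …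
Polynomial : Set
Polynomial = List ℤ

eval : Polynomial → ℤ → ℤ
eval p x = foldr (λ a r → a ℤ.+ x ℤ.* r) 0ℤ p

-- The polynomial s(1) t + s(2) t² + … + s(n) tⁿ.
Σ[1⋯_] : ℕ → (ℕ → ℤ) → Polynomial
Σ[1⋯ n ] s = 0ℤ ∷ applyUpTo (λ k → s (suc k)) n

-- The values at t ∈ ℕ determine a polynomial, so at most one polynomial
-- (up to trailing zero coefficients) satisfies this for a given graph.
IsChromaticPolynomial : ∀ {n} → Graph n → Polynomial → Set
IsChromaticPolynomial G p = ∀ (t : ℕ) → eval p (+ t) ≡ + #properColourings G t

------------------------------------------------------------------------
-- The graph Γ_A

OddBelowEven : ℕ → ℕ → Set
OddBelowEven u v = u < v × Odd u × Even v

oddBelowEven? : B.Decidable OddBelowEven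
oddBelowEven? u v = (u ℕ.<? v) ×-dec odd? u ×-dec even? v

Γ : (A : FiniteSubset) → Graph (card A)
Γ A = record
  { Adjacent    = λ i j → OddBelowEven (element A i) (element A j)
                        ⊎ OddBelowEven (element A j) (element A i)
  ; symmetric   = swap
  ; irreflexive = λ { refl → [ ℕ.<-irrefl refl ∘ proj₁ , ℕ.<-irrefl refl ∘ proj₁ ] }
  ; adjacent?   = λ i j → oddBelowEven? (element A i) (element A j)
                        ⊎-dec oddBelowEven? (element A j) (element A i)
  }

------------------------------------------------------------------------
-- Permutations and cycles

-- A self-map of Fin n is stored as the vector of its values.
IsPermutation : ∀ {n} → Vec (Fin n) n → Set
IsPermutation σ = Bijective _≡_ _≡_ (lookup σ)

isPermutation? : ∀ {n} → U.Decidable (IsPermutation {n})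
isPermutation? σ = injective? ×-dec surjective?
  where
  f = lookup σ

  injective? : Dec (Injective _≡_ _≡_ f)
  injective? = map′ (λ h {x} {y} → h x y) (λ h x y → h {x} {y})
    (all? λ x → all? λ y → (f x ≟ f y) →-dec (x ≟ y))

  surjective? : Dec (Surjective _≡_ _≡_ f)
  surjective? = map′ strictlySurjective⇒surjective surjective⇒strictlySurjective
    (all? λ y → any? λ x → f x ≟ y)

-- `fold i (lookup σ) k` is σᵏ(i).
SameCycle : ∀ {n} → Vec (Fin n) n → Rel (Fin n) 0ℓ
SameCycle σ i j = ∃[ k ] fold i (lookup σ) k ≡ j

-- Among the iterates of i, those with exponent below n exhaust the orbit.
module _ {n : ℕ} (f : Fin n → Fin n) (i : Fin n) where

  private
    shorten : ∃[ k ] k < n × fold i f k ≡ fold i f n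
    shorten with pigeonhole ℕ.≤-refl (λ (k : Fin (suc n)) → fold i f (toℕ k))
    ... | a , b , a<b , fᵃ≡fᵇ = n ∸ toℕ b + toℕ a , smaller , same
      where
      b≤n : toℕ b ≤ n
      b≤n = toℕ≤pred[n] b

      smaller : n ∸ toℕ b + toℕ a < n
      smaller = subst (n ∸ toℕ b + toℕ a <_) (ℕ.m∸n+n≡m b≤n)
                      (ℕ.+-monoʳ-< (n ∸ toℕ b) a<b)

      open ≡-Reasoning

      same : fold i f (n ∸ toℕ b + toℕ a) ≡ fold i f n
      same = begin
        fold i f (n ∸ toℕ b + toℕ a)           ≡⟨ fold-+ i f (n ∸ toℕ b) ⟩
        fold (fold i f (toℕ a)) f (n ∸ toℕ b)  ≡⟨ cong (λ x → fold x f (n ∸ toℕ b)) fᵃ≡fᵇ ⟩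
        fold (fold i f (toℕ b)) f (n ∸ toℕ b)  ≡⟨ fold-+ i f (n ∸ toℕ b) ⟨
        fold i f (n ∸ toℕ b + toℕ b)           ≡⟨ cong (fold i f) (ℕ.m∸n+n≡m b≤n) ⟩
        fold i f n                             ∎

  fold-bounded : ∀ k → ∃[ l ] l < n × fold i f l ≡ fold i f k
  fold-bounded zero = 0 , ℕ.≤-<-trans z≤n (toℕ<n i) , refl
  fold-bounded (suc k) with fold-bounded k
  ... | l , l<n , eq with suc l ℕ.<? n
  ...   | yes 1+l<n = suc l , 1+l<n , cong f eq
  ...   | no  1+l≮n with shorten
  ...     | m , m<n , eq′ =
    m , m<n , trans eq′ (trans (cong (fold i f) (ℕ.≤-antisym (ℕ.≮⇒≥ 1+l≮n) l<n)) (cong f eq))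

sameCycle? : ∀ {n} (σ : Vec (Fin n) n) → B.Decidable (SameCycle σ)
sameCycle? {n} σ i j =
  map′ (λ (k , _ , eq) → k , eq)
       (λ (k , eq) → let l , l<n , eq′ = fold-bounded (lookup σ) i k in l , l<n , trans eq′ eq)
       (ℕ.anyUpTo? (λ k → fold i (lookup σ) k ≟ j) n)

-- For a permutation σ, SameCycle σ is an equivalence relation, and the
-- deduplicated list contains exactly one position from each cycle.
#cycles : ∀ {n} → Vec (Fin n) n → ℕ
#cycles {n} σ = length (deduplicate (sameCycle? σ) (allFin n))

------------------------------------------------------------------------
-- D-permutations

record IsDPermutation (A : FiniteSubset) (σ : Vec (Fin (card A)) (card A)) : Set where
  constructor mkIsDPermutation
  field
    isPermutation : IsPermutation σ
    onOdd  : ∀ i → Odd  (element A i) → element A i ≤ element A (lookup σ i)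
    onEven : ∀ i → Even (element A i) → element A (lookup σ i) ≤ element A i

isDPermutation? : ∀ A → U.Decidable (IsDPermutation A)
isDPermutation? A σ =
  map′ (λ (p , o , e) → mkIsDPermutation p o e)
       (λ (mkIsDPermutation p o e) → p , o , e)
       (isPermutation? σ
         ×-dec (all? λ i → odd?  (element A i) →-dec (element A i ℕ.≤? element A (lookup σ i)))
         ×-dec (all? λ i → even? (element A i) →-dec (element A (lookup σ i) ℕ.≤? element A i)))

#DPermutations : FiniteSubset → ℕ → ℕ
#DPermutations A k = count (λ σ → isDPermutation? A σ ×-dec (#cycles σ ℕ.≟ k))

{-# OPTIONS --safe #-}
-- Since t^(#cycles σ) counts the t-colourings that are constant on the cycles of σ, the right
-- hand side at t is the sum of sgn σ over all pairs of a D-permutation σ and a colouring c with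
-- c ∘ σ = c.  Fix c.  If c is not proper, choose u odd, v even, u < v, of the same colour and
-- with no element of that colour in between; then σ ↦ (u v) ∘ σ is a sign-reversing involution
-- on the D-permutations preserving c.  If c is proper, then σ cannot map odd to even elements
-- or vice versa, so it is monotone on each cycle and hence the identity.
module Submission where

open import Defs
open import Data.Bool.Base using (if_then_else_)
open import Data.Fin.Base using (Fin; zero; suc; toℕ; fromℕ<; opposite)
open import Data.Fin.Permutation.Components using (transpose)
open import Data.Fin.Properties
  using (_≟_; all?; any?; pigeonhole; opposite-involutive; suc-injective; toℕ-injective; toℕ-fromℕ<)
open import Data.Integer.Base using (ℤ; +_; 0ℤ; 1ℤ; -1ℤ; _+_; _*_; -_; _^_)
open import Data.Integer.Properties
  using (+-assoc; +-identityˡ; +-injective; *-assoc; *-comm; *-identityˡ; *-zeroʳ;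
         *-distribˡ-+; pos-*; neg-distribʳ-*; neg-involutive; neg-distrib-+; -1*i≡-i)
open import Data.Integer.Tactic.RingSolver using (solve-∀)
open import Data.List.Base as List
  using (List; []; _∷_; _++_; allFin; applyUpTo; cartesianProductWith; deduplicate; filter; length)
open import Data.List.Membership.Propositional.Properties using (∈-lookup)
open import Data.List.Properties
  using (map-tabulate; filter-all; filter-accept; filter-reject; length-deduplicate;
         length-tabulate; length-map)
open import Data.List.Relation.Unary.All as All using (All; []; _∷_)
open import Data.List.Relation.Unary.All.Properties using (all-filter)
open import Data.List.Relation.Unary.AllPairs as AllPairs using (AllPairs; []; _∷_)
import Data.List.Relation.Unary.AllPairs.Properties as AllPairsₚ
open import Data.List.Relation.Unary.Any using (Any; here; there)
open import Data.List.Relation.Unary.Any.Properties using (deduplicate⁺; tabulate⁺)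
open import Data.List.Relation.Unary.Linked.Properties using (Linked⇒AllPairs)
open import Data.Nat.Base as ℕ using (ℕ; zero; suc; _∸_; _≤_; _<_; z≤n; s≤s)
open import Data.Nat.GeneralisedArithmetic using (fold; fold-+)
import Data.Nat.Properties as ℕ
open import Data.Product.Base using (∃-syntax; Σ-syntax; _×_; _,_; proj₁; proj₂)
open import Data.Sum.Base using (_⊎_; inj₁; inj₂)
open import Data.Vec.Base as Vec using (Vec; _∷_; lookup)
open import Data.Vec.Properties
  using (≡-dec; ∷-injective; lookup∘tabulate; lookup-allFin; lookup-map; map-∘; map-cong; map-id;
         tabulate∘lookup; tabulate-cong)
open import Function.Base using (_∘_; id; flip; _on_)
open import Function.Consequences.Propositional using (strictlySurjective⇒surjective)
open import Function.Definitions using (Injective)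
open import Level using (0ℓ)
open import Relation.Binary.Core using (Rel)
import Relation.Binary.Construct.On as On
open import Relation.Binary.Definitions as B using (tri<; tri≈; tri>)
open import Relation.Binary.Structures using (IsEquivalence)
open import Relation.Binary.PropositionalEquality
  using (_≡_; _≢_; refl; sym; trans; cong; cong₂; subst; module ≡-Reasoning)
open import Relation.Nullary.Decidable
  using (Dec; yes; no; does; dec-true; dec-false; ¬?; _×-dec_; _⊎-dec_; _→-dec_)
open import Relation.Nullary.Negation using (¬_; contradiction)
import Relation.Unary as U

-- A coefficient sees a permutation only through its number of cycles, so the sign has to be read
-- off from that number as well, as (-1)^(n - cycles). The obstacle is then to show that composing
-- with a transposition of two distinct points changes the number of cycles by exactly one.
-- Comparing two lists of cycle representatives directly would be unwieldy. Instead, the count of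
-- invariant t-colourings by t^(cycles) is used a second time, with t = 2: since powers of 2
-- determine their exponents, numbers of cycles can be compared by counting 2-colourings. Sums run
-- over all vectors, with indicators as weights, so that an involution on permutations only has to
-- be given as a map on vectors, and reindexing along it becomes an exchange of double sums.

private
  variable
    A B : Set
    P Q : Set
    m n : ℕ

-- Finite integer sums over lists

∑ : List A → (A → ℤ) → ℤ
∑ []       f = 0ℤ
∑ (x ∷ xs) f = f x + ∑ xs f

syntax ∑ xs (λ x → e) = ∑[ x ← xs ] e

+-congˡ : (x : ℤ) {y z : ℤ} → y ≡ z → x + y ≡ x + z
+-congˡ x = cong (λ y → x + y)

∑-cong : (xs : List A) {f g : A → ℤ} → (∀ x → f x ≡ g x) → ∑ xs f ≡ ∑ xs g
∑-cong []       f≗g = refl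
∑-cong (x ∷ xs) f≗g = cong₂ _+_ (f≗g x) (∑-cong xs f≗g)

∑-zero : (xs : List A) → ∑[ x ← xs ] 0ℤ ≡ 0ℤ
∑-zero []       = refl
∑-zero (x ∷ xs) = trans (+-identityˡ _) (∑-zero xs)

∑-distrib-+ : (xs : List A) (f g : A → ℤ) → ∑[ x ← xs ] (f x + g x) ≡ ∑ xs f + ∑ xs g
∑-distrib-+ []       f g = refl
∑-distrib-+ (x ∷ xs) f g =
  trans (+-congˡ (f x + g x) (∑-distrib-+ xs f g)) (interchange (f x) (g x) (∑ xs f) (∑ xs g))
  where
  interchange : ∀ a b c d → a + b + (c + d) ≡ a + c + (b + d)
  interchange = solve-∀

∑-*ˡ : (a : ℤ) (xs : List A) (f : A → ℤ) → a * ∑ xs f ≡ ∑[ x ← xs ] (a * f x)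
∑-*ˡ a []       f = *-zeroʳ a
∑-*ˡ a (x ∷ xs) f = trans (*-distribˡ-+ a (f x) (∑ xs f)) (+-congˡ (a * f x) (∑-*ˡ a xs f))

∑-*ʳ : (a : ℤ) (xs : List A) (f : A → ℤ) → ∑ xs f * a ≡ ∑[ x ← xs ] (f x * a)
∑-*ʳ a xs f = begin
  ∑ xs f * a              ≡⟨ *-comm (∑ xs f) a ⟩
  a * ∑ xs f              ≡⟨ ∑-*ˡ a xs f ⟩
  ∑[ x ← xs ] (a * f x)   ≡⟨ ∑-cong xs (λ x → *-comm a (f x)) ⟩
  ∑[ x ← xs ] (f x * a)   ∎
  where open ≡-Reasoning

∑-neg : (xs : List A) (f : A → ℤ) → ∑[ x ← xs ] (- f x) ≡ - ∑ xs f
∑-neg []       f = refl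
∑-neg (x ∷ xs) f = trans (+-congˡ (- f x) (∑-neg xs f)) (sym (neg-distrib-+ (f x) (∑ xs f)))

∑-swap : (xs : List A) (ys : List B) (f : A → B → ℤ) →
         ∑[ x ← xs ] ∑[ y ← ys ] f x y ≡ ∑[ y ← ys ] ∑[ x ← xs ] f x y
∑-swap []       ys f = sym (∑-zero ys)
∑-swap (x ∷ xs) ys f = trans (+-congˡ (∑ ys (f x)) (∑-swap xs ys f))
                             (sym (∑-distrib-+ ys (f x) (λ y → ∑[ x ← xs ] f x y)))

∑-++ : (xs ys : List A) (f : A → ℤ) → ∑ (xs ++ ys) f ≡ ∑ xs f + ∑ ys f
∑-++ []       ys f = sym (+-identityˡ _)
∑-++ (x ∷ xs) ys f = trans (+-congˡ (f x) (∑-++ xs ys f)) (sym (+-assoc (f x) (∑ xs f) (∑ ys f)))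

∑-map : (g : A → B) (xs : List A) (f : B → ℤ) → ∑ (List.map g xs) f ≡ ∑ xs (f ∘ g)
∑-map g []       f = refl
∑-map g (x ∷ xs) f = +-congˡ (f (g x)) (∑-map g xs f)

∑-allFin-suc : (f : Fin (suc n) → ℤ) → ∑ (allFin (suc n)) f ≡ f zero + ∑ (allFin n) (f ∘ suc)
∑-allFin-suc {n} f = +-congˡ (f zero)
  (trans (cong (λ xs → ∑ xs f) (sym (map-tabulate id suc))) (∑-map suc (allFin n) f))

∑-allVecs-suc : (f : Vec (Fin m) (suc n) → ℤ) →
  ∑ (allVecs m (suc n)) f ≡ ∑[ x ← allFin m ] ∑[ v ← allVecs m n ] f (x ∷ v)
∑-allVecs-suc {m} {n} f = product (allFin m)
  where
  product : ∀ xs → ∑ (cartesianProductWith _∷_ xs (allVecs m n)) f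
                 ≡ ∑[ x ← xs ] ∑[ v ← allVecs m n ] f (x ∷ v)
  product []       = refl
  product (x ∷ xs) = trans (∑-++ (List.map (x ∷_) (allVecs m n)) _ f)
    (cong₂ _+_ (∑-map (x ∷_) (allVecs m n) f) (product xs))

-- Indicators of decidable statements

𝟙 : Dec P → ℤ
𝟙 p? = if does p? then 1ℤ else 0ℤ

𝟙-yes : (p? : Dec P) → P → 𝟙 p? ≡ 1ℤ
𝟙-yes p? p rewrite dec-true p? p = refl

𝟙-no : (p? : Dec P) → ¬ P → 𝟙 p? ≡ 0ℤ
𝟙-no p? ¬p rewrite dec-false p? ¬p = refl

𝟙-cong : (p? : Dec P) (q? : Dec Q) → (P → Q) → (Q → P) → 𝟙 p? ≡ 𝟙 q?
𝟙-cong (yes p) q? f g = sym (𝟙-yes q? (f p))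
𝟙-cong (no ¬p) q? f g = sym (𝟙-no q? (¬p ∘ g))

𝟙-× : (p? : Dec P) (q? : Dec Q) → 𝟙 (p? ×-dec q?) ≡ 𝟙 p? * 𝟙 q?
𝟙-× (yes p) q? = sym (*-identityˡ (𝟙 q?))
𝟙-× (no ¬p) q? = refl

𝟙-split : (p? : Dec P) (q? : Dec Q) → 𝟙 p? ≡ 𝟙 (p? ×-dec q?) + 𝟙 (p? ×-dec ¬? q?)
𝟙-split (yes p) (yes q) = refl
𝟙-split (yes p) (no ¬q) = refl
𝟙-split (no ¬p) q?      = refl

length-filter≡∑ : {P : U.Pred A 0ℓ} (P? : U.Decidable P) (xs : List A) →
                  + length (filter P? xs) ≡ ∑[ x ← xs ] 𝟙 (P? x)
length-filter≡∑ P? []       = refl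
length-filter≡∑ P? (x ∷ xs) with P? x
... | yes _ = +-congˡ 1ℤ (length-filter≡∑ P? xs)
... | no  _ = trans (length-filter≡∑ P? xs) (sym (+-identityˡ _))

-- Sums over complete enumerations

-- Multiplicity one is phrased as a sum so that it can be used inside other sums, where 𝟙 (x ≈? a)
-- acts as a Kronecker delta.
Enumerates : B.DecidableEquality A → List A → Set
Enumerates _≈?_ xs = ∀ a → ∑[ x ← xs ] 𝟙 (x ≈? a) ≡ 1ℤ

module _ (_≈?_ : B.DecidableEquality A) (xs : List A) (enum : Enumerates _≈?_ xs) where

  ∑-pick : (a : A) (f : A → ℤ) → ∑[ x ← xs ] (𝟙 (x ≈? a) * f x) ≡ f a
  ∑-pick a f = begin
    ∑[ x ← xs ] (𝟙 (x ≈? a) * f x)  ≡⟨ ∑-cong xs agree ⟩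
    ∑[ x ← xs ] (𝟙 (x ≈? a) * f a)  ≡⟨ ∑-*ʳ (f a) xs _ ⟨
    (∑[ x ← xs ] 𝟙 (x ≈? a)) * f a  ≡⟨ cong (_* f a) (enum a) ⟩
    1ℤ * f a                        ≡⟨ *-identityˡ (f a) ⟩
    f a                             ∎
    where
    open ≡-Reasoning
    agree : ∀ x → 𝟙 (x ≈? a) * f x ≡ 𝟙 (x ≈? a) * f a
    agree x with x ≈? a
    ... | yes refl = refl
    ... | no  _    = refl

  -- Each f (ι x) is expanded as a sum over y against the delta of y and ι x. As ι is an involution,
  -- this delta is also that of x and ι y, so after the exchange of sums every y is met by exactly
  -- one x.
  ∑-involution : (ι : A → A) → (∀ x → ι (ι x) ≡ x) → (f : A → ℤ) → ∑ xs (f ∘ ι) ≡ ∑ xs f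
  ∑-involution ι inv f = begin
    ∑[ x ← xs ] f (ι x)                                 ≡⟨ ∑-cong xs (λ x → ∑-pick (ι x) f) ⟨
    ∑[ x ← xs ] ∑[ y ← xs ] (𝟙 (y ≈? ι x) * f y)        ≡⟨ ∑-swap xs xs _ ⟩
    ∑[ y ← xs ] ∑[ x ← xs ] (𝟙 (y ≈? ι x) * f y)        ≡⟨ ∑-cong xs (λ y → ∑-cong xs λ x →
                                                             cong (_* f y) (𝟙-cong (y ≈? ι x) (x ≈? ι y) adj adj)) ⟩
    ∑[ y ← xs ] ∑[ x ← xs ] (𝟙 (x ≈? ι y) * f y)        ≡⟨ ∑-cong xs (λ y → ∑-pick (ι y) (λ _ → f y)) ⟩
    ∑[ y ← xs ] f y                                     ∎
    where
    open ≡-Reasoning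
    adj : ∀ {x y} → x ≡ ι y → y ≡ ι x
    adj {y = y} refl = sym (inv y)

allFin-enumerates : Enumerates _≟_ (allFin n)
allFin-enumerates {suc n} a = trans (∑-allFin-suc {n} (λ x → 𝟙 (x ≟ a))) (step a)
  where
  open ≡-Reasoning
  step : ∀ a → 𝟙 (zero ≟ a) + ∑[ x ← allFin n ] 𝟙 (suc x ≟ a) ≡ 1ℤ
  step zero    = +-congˡ 1ℤ (∑-zero (allFin n))
  step (suc a) = begin
    0ℤ + ∑[ x ← allFin n ] 𝟙 (suc x ≟ suc a)  ≡⟨ +-identityˡ _ ⟩
    ∑[ x ← allFin n ] 𝟙 (suc x ≟ suc a)       ≡⟨ ∑-cong (allFin n) (λ x → 𝟙-cong (suc x ≟ suc a) (x ≟ a) suc-injective (cong suc)) ⟩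
    ∑[ x ← allFin n ] 𝟙 (x ≟ a)               ≡⟨ allFin-enumerates a ⟩
    1ℤ                                        ∎

allVecs-enumerates : Enumerates (≡-dec _≟_) (allVecs m n)
allVecs-enumerates {m} {zero}  Vec.[]  = refl
allVecs-enumerates {m} {suc n} (a ∷ w) = begin
  ∑[ v ← allVecs m (suc n) ] 𝟙 (v ≟ᵛ (a ∷ w))                              ≡⟨ ∑-allVecs-suc {m} {n} _ ⟩
  ∑[ x ← allFin m ] ∑[ v ← allVecs m n ] 𝟙 ((x ∷ v) ≟ᵛ (a ∷ w))            ≡⟨ ∑-cong (allFin m) (λ x → ∑-cong (allVecs m n) (split x)) ⟩
  ∑[ x ← allFin m ] ∑[ v ← allVecs m n ] (𝟙 (x ≟ a) * 𝟙 (v ≟ᵛ w))          ≡⟨ ∑-cong (allFin m) (λ x → ∑-*ˡ (𝟙 (x ≟ a)) (allVecs m n) _) ⟨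
  ∑[ x ← allFin m ] (𝟙 (x ≟ a) * ∑[ v ← allVecs m n ] 𝟙 (v ≟ᵛ w))          ≡⟨ ∑-pick _≟_ (allFin m) allFin-enumerates a (λ _ → ∑[ v ← allVecs m n ] 𝟙 (v ≟ᵛ w)) ⟩
  ∑[ v ← allVecs m n ] 𝟙 (v ≟ᵛ w)                                          ≡⟨ allVecs-enumerates w ⟩
  1ℤ                                                                       ∎
  where
  open ≡-Reasoning
  _≟ᵛ_ : ∀ {k} → B.DecidableEquality (Vec (Fin m) k)
  _≟ᵛ_ = ≡-dec _≟_
  split : ∀ x v → 𝟙 ((x ∷ v) ≟ᵛ (a ∷ w)) ≡ 𝟙 (x ≟ a) * 𝟙 (v ≟ᵛ w)
  split x v = trans
    (𝟙-cong ((x ∷ v) ≟ᵛ (a ∷ w)) ((x ≟ a) ×-dec (v ≟ᵛ w)) ∷-injective (λ (p , q) → cong₂ _∷_ p q))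
    (𝟙-× (x ≟ a) (v ≟ᵛ w))

-- Equivalence classes

filter-map : {P : U.Pred B 0ℓ} (P? : U.Decidable P) (f : A → B) (xs : List A) →
             filter P? (List.map f xs) ≡ List.map f (filter (P? ∘ f) xs)
filter-map P? f []       = refl
filter-map P? f (x ∷ xs) with P? (f x)
... | yes _ = cong (f x ∷_) (filter-map P? f xs)
... | no  _ = filter-map P? f xs

deduplicate-map : {R : Rel B 0ℓ} (R? : B.Decidable R) (f : A → B) (xs : List A) →
                  deduplicate R? (List.map f xs) ≡ List.map f (deduplicate (λ x y → R? (f x) (f y)) xs)
deduplicate-map R? f []       = refl
deduplicate-map R? f (x ∷ xs) = cong (f x ∷_)
  (trans (cong (filter (¬? ∘ R? (f x))) (deduplicate-map R? f xs))
         (filter-map (¬? ∘ R? (f x)) f (deduplicate (λ x y → R? (f x) (f y)) xs)))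

deduplicate-AllPairs : {R : Rel A 0ℓ} (R? : B.Decidable R) (xs : List A) →
                       AllPairs (λ x y → ¬ R x y) (deduplicate R? xs)
deduplicate-AllPairs R? []       = []
deduplicate-AllPairs R? (x ∷ xs) =
  all-filter (¬? ∘ R? x) (deduplicate R? xs) ∷ AllPairsₚ.filter⁺ (¬? ∘ R? x) (deduplicate-AllPairs R? xs)

-- Pairwise unrelated entries contain at most one with `P`, because two such entries would be
-- related; `Any` supplies one. Applied to representatives, this says that discarding one class
-- discards one representative.
length-filter-one : {R : Rel A 0ℓ} {P : U.Pred A 0ℓ} (P? : U.Decidable P) →
  (∀ {x y} → P x → P y → R x y) →
  ∀ {xs} → AllPairs (λ x y → ¬ R x y) xs → Any P xs →
  suc (length (filter (¬? ∘ P?) xs)) ≡ length xs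
length-filter-one P? together {x ∷ xs} (x#xs ∷ _) (here px) = cong (suc ∘ length) (begin
  filter (¬? ∘ P?) (x ∷ xs)  ≡⟨ filter-reject (¬? ∘ P?) (λ ¬px → ¬px px) ⟩
  filter (¬? ∘ P?) xs        ≡⟨ filter-all (¬? ∘ P?) (All.map (λ ¬r py → ¬r (together px py)) x#xs) ⟩
  xs                         ∎)
  where open ≡-Reasoning
length-filter-one P? together {x ∷ xs} (x#xs ∷ xs#) (there pxs) = cong suc (begin
  length (filter (¬? ∘ P?) (x ∷ xs))  ≡⟨ cong length (filter-accept (¬? ∘ P?) ¬px) ⟩
  suc (length (filter (¬? ∘ P?) xs))  ≡⟨ length-filter-one P? together xs# pxs ⟩
  length xs                           ∎)
  where
  open ≡-Reasoning
  ¬px : ¬ _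
  ¬px px = All.lookupWith (λ ¬r py → ¬r (together px py)) x#xs pxs

Respects : Rel (Fin n) 0ℓ → Vec A n → Set
Respects R c = ∀ i j → R i j → lookup c i ≡ lookup c j

pos-^ : ∀ m n → (+ m) ^ n ≡ + (m ℕ.^ n)
pos-^ m zero    = refl
pos-^ m (suc n) = trans (cong (_*_ (+ m)) (pos-^ m n)) (sym (pos-* m (m ℕ.^ n)))

∑-one : ∀ t → ∑[ x ← allFin t ] 1ℤ ≡ + t
∑-one zero    = refl
∑-one (suc t) = trans (∑-allFin-suc {t} (λ _ → 1ℤ)) (+-congˡ 1ℤ (∑-one t))

-- `#cycles σ` unfolds to `#classes (sameCycle? σ)`. The count is studied for arbitrary relations
-- because an equivalence restricts along `suc` at once, while removing a position from a
-- permutation would require rerouting its cycle.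
#classes : {R : Rel (Fin n) 0ℓ} → B.Decidable R → ℕ
#classes {n} R? = length (deduplicate R? (allFin n))

module _ {R : Rel (Fin (suc n)) 0ℓ} (R? : B.Decidable R) where

  private
    R?′ : B.Decidable (R on suc)
    R?′ = On.decidable suc R R?

    representatives : List (Fin n)
    representatives = deduplicate R?′ (allFin n)

  #classes-suc : #classes R? ≡ suc (length (filter (¬? ∘ R? zero ∘ suc) representatives))
  #classes-suc = cong suc (begin
    length (filter (¬? ∘ R? zero) (deduplicate R? (List.tabulate suc)))
      ≡⟨ cong (λ xs → length (filter (¬? ∘ R? zero) (deduplicate R? xs))) (map-tabulate id suc) ⟨
    length (filter (¬? ∘ R? zero) (deduplicate R? (List.map suc (allFin n))))
      ≡⟨ cong (length ∘ filter (¬? ∘ R? zero)) (deduplicate-map R? suc (allFin n)) ⟩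
    length (filter (¬? ∘ R? zero) (List.map suc representatives))
      ≡⟨ cong length (filter-map (¬? ∘ R? zero) suc representatives) ⟩
    length (List.map suc (filter (¬? ∘ R? zero ∘ suc) representatives))
      ≡⟨ length-map suc (filter (¬? ∘ R? zero ∘ suc) representatives) ⟩
    length (filter (¬? ∘ R? zero ∘ suc) representatives) ∎)
    where open ≡-Reasoning

  #classes-isolated : (∀ j → ¬ R zero (suc j)) → #classes R? ≡ suc (#classes R?′)
  #classes-isolated isolated = trans #classes-suc
    (cong (suc ∘ length) (filter-all (¬? ∘ R? zero ∘ suc) (All.universal isolated representatives)))

  -- The new representative `zero` is offset by the single old representative of its class, which
  -- the filter removes.
  #classes-joined : IsEquivalence R → ∀ j → R zero (suc j) → #classes R? ≡ #classes R?′
  #classes-joined equiv j 0~j = trans #classes-suc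
    (length-filter-one (R? zero ∘ suc) (λ p q → E.trans (E.sym p) q) (deduplicate-AllPairs R?′ (allFin n))
      (deduplicate⁺ R?′ (λ r p → E.trans p (E.sym r)) (tabulate⁺ j 0~j)))
    where module E = IsEquivalence equiv

respects? : ∀ {t} {R : Rel (Fin n) 0ℓ} → B.Decidable R → U.Decidable (Respects {n} {Fin t} R)
respects? R? c = all? λ i → all? λ j → R? i j →-dec (lookup c i ≟ lookup c j)

-- Induction on the number of positions. If `zero` is related to a later position, its colour is
-- forced and no class is added; otherwise its colour is free, which gives a factor t for the added
-- class.
∑-respects : ∀ {n t} {R : Rel (Fin n) 0ℓ} (R? : B.Decidable R) → IsEquivalence R →
             ∑[ c ← allVecs t n ] 𝟙 (respects? R? c) ≡ (+ t) ^ #classes R?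
∑-respects {zero}          R? equiv = refl
∑-respects {suc n} {t} {R} R? equiv = cases (any? λ j → R? zero (suc j))
  where
  open ≡-Reasoning
  module E = IsEquivalence equiv

  R?′ : B.Decidable (R on suc)
  R?′ = On.decidable suc R R?

  ih : ∑[ c ← allVecs t n ] 𝟙 (respects? R?′ c) ≡ (+ t) ^ #classes R?′
  ih = ∑-respects R?′ (On.isEquivalence suc equiv)

  forced : ∀ j → R zero (suc j) → ∀ x c →
           𝟙 (respects? R? (x ∷ c)) ≡ 𝟙 (x ≟ lookup c j) * 𝟙 (respects? R?′ c)
  forced j 0~j x c = trans
    (𝟙-cong (respects? R? (x ∷ c)) ((x ≟ lookup c j) ×-dec respects? R?′ c)
      (λ r → r zero (suc j) 0~j , λ i k → r (suc i) (suc k))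
      λ where
        (x≡ , r) zero    zero    _ → refl
        (x≡ , r) zero    (suc k) q → trans x≡ (r j k (E.trans (E.sym 0~j) q))
        (x≡ , r) (suc i) zero    q → trans (r i j (E.trans q 0~j)) (sym x≡)
        (x≡ , r) (suc i) (suc k) q → r i k q)
    (𝟙-× (x ≟ lookup c j) (respects? R?′ c))

  free : (∀ j → ¬ R zero (suc j)) → ∀ x c → 𝟙 (respects? R? (x ∷ c)) ≡ 𝟙 (respects? R?′ c)
  free isolated x c = 𝟙-cong (respects? R? (x ∷ c)) (respects? R?′ c)
    (λ r i k → r (suc i) (suc k))
    λ where
      r zero    zero    _ → refl
      r zero    (suc k) q → contradiction q (isolated k)
      r (suc i) zero    q → contradiction (E.sym q) (isolated i)
      r (suc i) (suc k) q → r i k q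

  cases : Dec (∃[ j ] R zero (suc j)) →
          ∑[ c ← allVecs t (suc n) ] 𝟙 (respects? R? c) ≡ (+ t) ^ #classes R?
  cases (yes (j , 0~j)) = begin
    ∑[ c ← allVecs t (suc n) ] 𝟙 (respects? R? c)
      ≡⟨ ∑-allVecs-suc {t} {n} (λ c → 𝟙 (respects? R? c)) ⟩
    ∑[ x ← allFin t ] ∑[ c ← allVecs t n ] 𝟙 (respects? R? (x ∷ c))
      ≡⟨ ∑-swap (allFin t) (allVecs t n) (λ x c → 𝟙 (respects? R? (x ∷ c))) ⟩
    ∑[ c ← allVecs t n ] ∑[ x ← allFin t ] 𝟙 (respects? R? (x ∷ c))
      ≡⟨ ∑-cong (allVecs t n) (λ c → ∑-cong (allFin t) (λ x → forced j 0~j x c)) ⟩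
    ∑[ c ← allVecs t n ] ∑[ x ← allFin t ] (𝟙 (x ≟ lookup c j) * 𝟙 (respects? R?′ c))
      ≡⟨ ∑-cong (allVecs t n) (λ c →
           ∑-pick _≟_ (allFin t) allFin-enumerates (lookup c j) (λ _ → 𝟙 (respects? R?′ c))) ⟩
    ∑[ c ← allVecs t n ] 𝟙 (respects? R?′ c)
      ≡⟨ ih ⟩
    (+ t) ^ #classes R?′
      ≡⟨ cong ((+ t) ^_) (#classes-joined R? equiv j 0~j) ⟨
    (+ t) ^ #classes R? ∎
  cases (no ¬joined) = begin
    ∑[ c ← allVecs t (suc n) ] 𝟙 (respects? R? c)
      ≡⟨ ∑-allVecs-suc {t} {n} (λ c → 𝟙 (respects? R? c)) ⟩
    ∑[ x ← allFin t ] ∑[ c ← allVecs t n ] 𝟙 (respects? R? (x ∷ c))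
      ≡⟨ ∑-cong (allFin t) (λ x → ∑-cong (allVecs t n) (free isolated x)) ⟩
    ∑[ x ← allFin t ] ∑[ c ← allVecs t n ] 𝟙 (respects? R?′ c)
      ≡⟨ ∑-cong (allFin t) (λ _ → trans ih (sym (*-identityˡ ((+ t) ^ #classes R?′)))) ⟩
    ∑[ x ← allFin t ] (1ℤ * (+ t) ^ #classes R?′)
      ≡⟨ ∑-*ʳ ((+ t) ^ #classes R?′) (allFin t) (λ _ → 1ℤ) ⟨
    (∑[ x ← allFin t ] 1ℤ) * (+ t) ^ #classes R?′
      ≡⟨ cong (_* ((+ t) ^ #classes R?′)) (∑-one t) ⟩
    (+ t) ^ suc (#classes R?′)
      ≡⟨ cong ((+ t) ^_) (#classes-isolated R? isolated) ⟨
    (+ t) ^ #classes R? ∎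
    where
    isolated : ∀ j → ¬ R zero (suc j)
    isolated j 0~j = ¬joined (j , 0~j)

-- Cycles of permutations

fold-comm : (f : A → A) (x : A) (k : ℕ) → fold (f x) f k ≡ f (fold x f k)
fold-comm f x zero    = refl
fold-comm f x (suc k) = cong f (fold-comm f x k)

fold-cancel : {f : A → A} → Injective _≡_ _≡_ f → ∀ {x y} k → fold x f k ≡ fold y f k → x ≡ y
fold-cancel inj zero    eq = eq
fold-cancel inj (suc k) eq = fold-cancel inj k (inj eq)

fold-period : (f : A → A) (x : A) (p : ℕ) → fold x f p ≡ x → ∀ k → fold x f (k ℕ.* p) ≡ x
fold-period f x p eq zero    = refl
fold-period f x p eq (suc k) =
  trans (fold-+ x f p) (trans (cong (λ y → fold y f p) (fold-period f x p eq k)) eq)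

-- Two of the first n + 1 iterates coincide, and injectivity cancels the smaller exponent from both.
-- The form `suc p` keeps the period positive.
periodic : {f : Fin n → Fin n} → Injective _≡_ _≡_ f → ∀ i → ∃[ p ] fold i f (suc p) ≡ i
periodic {n} {f} inj i with pigeonhole ℕ.≤-refl (λ (k : Fin (suc n)) → fold i f (toℕ k))
... | a , b , a<b , fᵃ≡fᵇ = p , sym (fold-cancel inj (toℕ a) (begin
  fold i f (toℕ a)                     ≡⟨ fᵃ≡fᵇ ⟩
  fold i f (toℕ b)                     ≡⟨ cong (fold i f) b≡ ⟩
  fold i f (toℕ a ℕ.+ suc p)           ≡⟨ fold-+ i f (toℕ a) ⟩
  fold (fold i f (suc p)) f (toℕ a)    ∎))
  where
  open ≡-Reasoning
  p : ℕ
  p = toℕ b ∸ suc (toℕ a)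
  b≡ : toℕ b ≡ toℕ a ℕ.+ suc p
  b≡ = sym (trans (ℕ.+-suc (toℕ a) p) (ℕ.m+[n∸m]≡n a<b))

sameCycle-isEquivalence : (σ : Vec (Fin n) n) → Injective _≡_ _≡_ (lookup σ) → IsEquivalence (SameCycle σ)
sameCycle-isEquivalence σ inj = record
  { refl  = 0 , refl
  ; sym   = λ {i} (k , eq) → back i k (periodic inj i) eq
  ; trans = λ (k , eq) (l , eq′) → l ℕ.+ k , trans (fold-+ _ f l) (trans (cong (λ x → fold x f l) eq) eq′)
  }
  where
  open ≡-Reasoning
  f = lookup σ
  back : ∀ i k {j} → ∃[ p ] fold i f (suc p) ≡ i → fold i f k ≡ j → SameCycle σ j i
  -- The k steps from i to j and k * p further ones make k * (p + 1) steps, that is, k full periods.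
  back i k {j} (p , period) eq = k ℕ.* p , (begin
    fold j f (k ℕ.* p)              ≡⟨ cong (λ x → fold x f (k ℕ.* p)) eq ⟨
    fold (fold i f k) f (k ℕ.* p)   ≡⟨ fold-+ i f (k ℕ.* p) ⟨
    fold i f (k ℕ.* p ℕ.+ k)        ≡⟨ cong (fold i f) (trans (ℕ.+-comm (k ℕ.* p) k) (sym (ℕ.*-suc k p))) ⟩
    fold i f (k ℕ.* suc p)          ≡⟨ fold-period f i (suc p) period k ⟩
    i                               ∎)

Invariant : Vec (Fin n) n → Vec A n → Set
Invariant σ c = ∀ i → lookup c (lookup σ i) ≡ lookup c i

invariant? : ∀ {t} (σ : Vec (Fin n) n) → U.Decidable (Invariant {n} {Fin t} σ)
invariant? σ c = all? λ i → lookup c (lookup σ i) ≟ lookup c i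

invariant⇒respects : (σ : Vec (Fin n) n) (c : Vec A n) → Invariant σ c → Respects (SameCycle σ) c
invariant⇒respects σ c inv i j (k , eq) = trans (sym (const k)) (cong (lookup c) eq)
  where
  const : ∀ k → lookup c (fold i (lookup σ) k) ≡ lookup c i
  const zero    = refl
  const (suc k) = trans (inv _) (const k)

respects⇒invariant : (σ : Vec (Fin n) n) (c : Vec A n) → Respects (SameCycle σ) c → Invariant σ c
respects⇒invariant σ c r i = sym (r i (lookup σ i) (1 , refl))

∑-invariant : ∀ {t} (σ : Vec (Fin n) n) → Injective _≡_ _≡_ (lookup σ) →
              ∑[ c ← allVecs t n ] 𝟙 (invariant? σ c) ≡ (+ t) ^ #cycles σ
∑-invariant {n} {t} σ inj = trans
  (∑-cong (allVecs t n) λ c → 𝟙-cong (invariant? σ c) (respects? (sameCycle? σ) c)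
    (invariant⇒respects σ c) (respects⇒invariant σ c))
  (∑-respects (sameCycle? σ) (sameCycle-isEquivalence σ inj))

-- Composition with a transposition

module _ (u v : Fin n) where

  -- `P` relates a point to its image, so every later distinction between u, v and the fixed points
  -- is a single application of this principle.
  transpose-elim : (P : Fin n → Fin n → Set) → P u v → P v u → (∀ k → k ≢ u → k ≢ v → P k k) →
                   ∀ k → P k (transpose u v k)
  transpose-elim P uv vu kk k with k ≟ u
  ... | yes refl = uv
  ... | no k≢u with k ≟ v
  ...   | yes refl = vu
  ...   | no  k≢v  = kk k k≢u k≢v

  transpose-fixed : ∀ k → k ≢ u → k ≢ v → transpose u v k ≡ k
  transpose-fixed k k≢u k≢v rewrite dec-false (k ≟ u) k≢u | dec-false (k ≟ v) k≢v = refl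

  transpose-left : transpose u v u ≡ v
  transpose-left rewrite dec-true (u ≟ u) refl = refl

  -- `transpose` tests for u first, and v may equal u, so both possibilities have to be covered.
  transpose-right : transpose u v v ≡ u
  transpose-right = transpose-elim (λ k l → k ≡ v → l ≡ u) sym (λ _ → refl)
    (λ _ _ k≢v k≡v → contradiction k≡v k≢v) v refl

  transpose-involutive : ∀ k → transpose u v (transpose u v k) ≡ k
  transpose-involutive = transpose-elim (λ k l → transpose u v l ≡ k)
    transpose-right transpose-left transpose-fixed

swapValues : (u v : Fin n) → Vec (Fin n) n → Vec (Fin n) n
swapValues u v = Vec.map (transpose u v)

lookup-swapValues : (u v : Fin n) (σ : Vec (Fin n) n) → ∀ i →
                    lookup (swapValues u v σ) i ≡ transpose u v (lookup σ i)
lookup-swapValues u v σ i = lookup-map i (transpose u v) σ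

swapValues-involutive : (u v : Fin n) (σ : Vec (Fin n) n) → swapValues u v (swapValues u v σ) ≡ σ
swapValues-involutive u v σ = trans (sym (map-∘ (transpose u v) (transpose u v) σ))
  (trans (map-cong (λ k → transpose-involutive u v k) σ) (map-id σ))

swapValues-injective : (u v : Fin n) (σ : Vec (Fin n) n) →
  Injective _≡_ _≡_ (lookup σ) → Injective _≡_ _≡_ (lookup (swapValues u v σ))
swapValues-injective u v σ inj {i} {j} eq = inj (begin
  lookup σ i                                    ≡⟨ transpose-involutive u v (lookup σ i) ⟨
  transpose u v (transpose u v (lookup σ i))    ≡⟨ cong (transpose u v) (begin
    transpose u v (lookup σ i)      ≡⟨ lookup-swapValues u v σ i ⟨
    lookup (swapValues u v σ) i     ≡⟨ eq ⟩
    lookup (swapValues u v σ) j     ≡⟨ lookup-swapValues u v σ j ⟩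
    transpose u v (lookup σ j)      ∎) ⟩
  transpose u v (transpose u v (lookup σ j))    ≡⟨ transpose-involutive u v (lookup σ j) ⟩
  lookup σ j                                    ∎)
  where open ≡-Reasoning

least : {P : U.Pred ℕ 0ℓ} → U.Decidable P → ∀ m → P m → ∃[ k ] P k × (∀ {j} → j < k → ¬ P j)
least P? m p with P? 0
... | yes p₀ = 0 , p₀ , λ ()
least P? zero    p | no ¬p₀ = contradiction p ¬p₀
least P? (suc m) p | no ¬p₀ with least (P? ∘ suc) m p
... | k , pk , before = suc k , pk , earlier
  where
  earlier : ∀ {j} → j < suc k → ¬ _
  earlier {zero}  _         = ¬p₀
  earlier {suc j} (s≤s j<k) = before j<k

-- As u recurs after k + 1 steps, every iterate is one with exponent at most k: the exponent is
-- reset to 0 whenever it would reach k + 1.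
orbit-avoids : (f : A → A) {u v : A} (k : ℕ) → u ≢ v → fold u f (suc k) ≡ u →
               (∀ {j} → j < k → fold u f (suc j) ≢ v) → ∀ j → fold u f j ≢ v
orbit-avoids f {u} {v} k u≢v period avoid j eq with reduce j
  where
  reduce : ∀ j → ∃[ i ] i ≤ k × fold u f j ≡ fold u f i
  reduce zero = 0 , z≤n , refl
  reduce (suc j) with reduce j
  ... | i , i≤k , eq with ℕ.m≤n⇒m<n∨m≡n i≤k
  ...   | inj₁ i<k  = suc i , i<k , cong f eq
  ...   | inj₂ refl = 0 , z≤n , trans (cong f eq) period
... | zero  , _   , eq′ = u≢v (trans (sym eq′) eq)
... | suc i , i<k , eq′ = avoid i<k (trans (sym eq′) eq)

-- Up to the first return k + 1 of u to {u , v} the orbits of u under σ and (u v) ∘ σ agree,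
-- and at k + 1 one of them is at u and the other at v.
swapValues-sameCycle : {u v : Fin n} (σ : Vec (Fin n) n) → Injective _≡_ _≡_ (lookup σ) → u ≢ v →
  (SameCycle σ u v × ¬ SameCycle (swapValues u v σ) u v) ⊎
  (¬ SameCycle σ u v × SameCycle (swapValues u v σ) u v)
swapValues-sameCycle {u = u} {v} σ inj u≢v = split (least returned? p (inj₁ period))
  where
  f = lookup σ
  g = lookup (swapValues u v σ)

  p = proj₁ (periodic inj u)
  period = proj₂ (periodic inj u)

  Returned : ℕ → Set
  Returned k = fold u f (suc k) ≡ u ⊎ fold u f (suc k) ≡ v

  returned? : U.Decidable Returned
  returned? k = (fold u f (suc k) ≟ u) ⊎-dec (fold u f (suc k) ≟ v)

  module _ (k : ℕ) (before : ∀ {j} → j < k → ¬ Returned j) where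

    agree : ∀ {j} → j ≤ k → fold u g j ≡ fold u f j
    agree {zero}  _   = refl
    agree {suc j} j<k = trans (cong g (agree (ℕ.<⇒≤ j<k))) (trans (lookup-swapValues u v σ _)
      (transpose-fixed u v _ (before j<k ∘ inj₁) (before j<k ∘ inj₂)))

    next : ∀ {x} → fold u f (suc k) ≡ x → fold u g (suc k) ≡ transpose u v x
    next eq = trans (cong g (agree ℕ.≤-refl))
      (trans (lookup-swapValues u v σ _) (cong (transpose u v) eq))

  split : ∃[ k ] Returned k × (∀ {j} → j < k → ¬ Returned j) → _
  split (k , inj₁ at-u , before) = inj₂
    ( (λ (j , eq) → orbit-avoids f k u≢v at-u (λ j<k → before j<k ∘ inj₂) j eq)
    , suc k , trans (next k before at-u) (transpose-left u v) )
  split (k , inj₂ at-v , before) = inj₁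
    ( (suc k , at-v)
    , λ (j , eq) → orbit-avoids g k u≢v (trans (next k before at-v) (transpose-right u v))
        (λ j<k eq → before j<k (inj₂ (trans (sym (agree k before j<k)) eq))) j eq )

-- Comparing numbers of cycles through 2-colourings

2^-≢ : ∀ {a b} → a < b → (+ 2) ^ a ≢ (+ 2) ^ b
2^-≢ {a} {b} a<b eq = ℕ.<⇒≢ (ℕ.^-monoʳ-< 2 ℕ.≤-refl a<b)
  (+-injective (trans (sym (pos-^ 2 a)) (trans eq (pos-^ 2 b))))

-- Two is the least number of colours for which the number of invariant colourings determines the
-- number of cycles.
2^-injective : ∀ {a b} → (+ 2) ^ a ≡ (+ 2) ^ b → a ≡ b
2^-injective {a} {b} eq with ℕ.<-cmp a b
... | tri< a<b _ _ = contradiction eq (2^-≢ a<b)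
... | tri≈ _ a≡b _ = a≡b
... | tri> _ _ b<a = contradiction (sym eq) (2^-≢ b<a)

opposite-≢ : {x y : Fin 2} → opposite x ≡ y → x ≢ y
opposite-≢ {zero}     () refl
opposite-≢ {suc zero} () refl

≢-opposite : {x y : Fin 2} → x ≢ y → opposite x ≡ y
≢-opposite {zero}     {zero}     x≢y = contradiction refl x≢y
≢-opposite {zero}     {suc zero} x≢y = refl
≢-opposite {suc zero} {zero}     x≢y = refl
≢-opposite {suc zero} {suc zero} x≢y = contradiction refl x≢y

-- Flipping the colours on the cycle of u shows that exactly half of the 2-colourings
-- invariant under σ give u and v the same colour; these are the colourings invariant
-- under (u v) ∘ σ.
#cycles-merge : {u v : Fin n} (σ : Vec (Fin n) n) → Injective _≡_ _≡_ (lookup σ) →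
  ¬ SameCycle σ u v → SameCycle (swapValues u v σ) u v →
  #cycles σ ≡ suc (#cycles (swapValues u v σ))
#cycles-merge {n} {u} {v} σ inj u≁v u~v = 2^-injective (begin
  (+ 2) ^ #cycles σ
    ≡⟨ ∑-invariant σ inj ⟨
  ∑[ c ← cs ] 𝟙 (invariant? σ c)
    ≡⟨ ∑-cong cs (λ c → 𝟙-split (invariant? σ c) (lookup c u ≟ lookup c v)) ⟩
  ∑[ c ← cs ] (equal c + unequal c)
    ≡⟨ ∑-distrib-+ cs equal unequal ⟩
  ∑ cs equal + ∑ cs unequal
    ≡⟨ +-congˡ (∑ cs equal) (trans (∑-cong cs unequal≡equal∘toggle)
         (∑-involution (≡-dec _≟_) cs allVecs-enumerates toggle toggle-involutive equal)) ⟩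
  ∑ cs equal + ∑ cs equal
    ≡⟨ double (∑ cs equal) ⟩
  (+ 2) * ∑ cs equal
    ≡⟨ cong (_*_ (+ 2)) (trans (∑-cong cs equal≡invariant) (∑-invariant τ (swapValues-injective u v σ inj))) ⟩
  (+ 2) ^ suc (#cycles τ) ∎)
  where
  open ≡-Reasoning
  module E = IsEquivalence (sameCycle-isEquivalence σ inj)
  cs = allVecs 2 n
  τ = swapValues u v σ

  double : ∀ x → x + x ≡ (+ 2) * x
  double = solve-∀

  equal unequal : Vec (Fin 2) n → ℤ
  equal   c = 𝟙 (invariant? σ c ×-dec (lookup c u ≟ lookup c v))
  unequal c = 𝟙 (invariant? σ c ×-dec ¬? (lookup c u ≟ lookup c v))

  toggleAt : Vec (Fin 2) n → Fin n → Fin 2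
  toggleAt c i = if does (sameCycle? σ u i) then opposite (lookup c i) else lookup c i

  toggle : Vec (Fin 2) n → Vec (Fin 2) n
  toggle c = Vec.tabulate (toggleAt c)

  toggleAt-on : ∀ c {i} → SameCycle σ u i → toggleAt c i ≡ opposite (lookup c i)
  toggleAt-on c {i} q =
    cong (if_then opposite (lookup c i) else lookup c i) (dec-true (sameCycle? σ u i) q)

  toggleAt-off : ∀ c {i} → ¬ SameCycle σ u i → toggleAt c i ≡ lookup c i
  toggleAt-off c {i} ¬q =
    cong (if_then opposite (lookup c i) else lookup c i) (dec-false (sameCycle? σ u i) ¬q)

  toggle-on : ∀ c {i} → SameCycle σ u i → lookup (toggle c) i ≡ opposite (lookup c i)
  toggle-on c {i} q = trans (lookup∘tabulate (toggleAt c) i) (toggleAt-on c q)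

  toggle-off : ∀ c {i} → ¬ SameCycle σ u i → lookup (toggle c) i ≡ lookup c i
  toggle-off c {i} ¬q = trans (lookup∘tabulate (toggleAt c) i) (toggleAt-off c ¬q)

  toggle-involutive : ∀ c → toggle (toggle c) ≡ c
  toggle-involutive c = trans (tabulate-cong (λ i → back i (sameCycle? σ u i))) (tabulate∘lookup c)
    where
    back : ∀ i → Dec (SameCycle σ u i) → toggleAt (toggle c) i ≡ lookup c i
    back i (yes q) = trans (toggleAt-on (toggle c) q)
      (trans (cong opposite (toggle-on c q)) (opposite-involutive (lookup c i)))
    back i (no ¬q) = trans (toggleAt-off (toggle c) ¬q) (toggle-off c ¬q)

  toggle-invariant : ∀ c → Invariant σ c → Invariant σ (toggle c)
  toggle-invariant c inv i with sameCycle? σ u i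
  ... | yes q = trans (toggle-on c (E.trans q (1 , refl)))
                      (trans (cong opposite (inv i)) (sym (toggle-on c q)))
  ... | no ¬q = trans (toggle-off c (λ q → ¬q (E.trans q (E.sym (1 , refl)))))
                      (trans (inv i) (sym (toggle-off c ¬q)))

  unequal≡equal∘toggle : ∀ c → unequal c ≡ equal (toggle c)
  unequal≡equal∘toggle c = 𝟙-cong
    (invariant? σ c ×-dec ¬? (lookup c u ≟ lookup c v))
    (invariant? σ (toggle c) ×-dec (lookup (toggle c) u ≟ lookup (toggle c) v))
    (λ (inv , u≢v) → toggle-invariant c inv ,
       trans (toggle-on c E.refl) (trans (≢-opposite u≢v) (sym (toggle-off c u≁v))))
    (λ (inv , u≡v) → subst (Invariant σ) (toggle-involutive c) (toggle-invariant (toggle c) inv) ,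
       opposite-≢ (trans (sym (toggle-on c E.refl)) (trans u≡v (toggle-off c u≁v))))

  equal≡invariant : ∀ c → equal c ≡ 𝟙 (invariant? τ c)
  equal≡invariant c = 𝟙-cong (invariant? σ c ×-dec (lookup c u ≟ lookup c v)) (invariant? τ c)
    (λ (inv , u≡v) i → trans (τ≈σ u≡v i) (inv i))
    (λ inv → let u≡v = invariant⇒respects τ c inv u v u~v in
       (λ i → trans (sym (τ≈σ u≡v i)) (inv i)) , u≡v)
    where
    τ≈σ : lookup c u ≡ lookup c v → ∀ i → lookup c (lookup τ i) ≡ lookup c (lookup σ i)
    τ≈σ u≡v i = trans (cong (lookup c) (lookup-swapValues u v σ i))
      (transpose-elim u v (λ k l → lookup c l ≡ lookup c k) (sym u≡v) u≡v (λ _ _ _ → refl) (lookup σ i))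

-- The sign of a permutation

#cycles≤n : (σ : Vec (Fin n) n) → #cycles σ ≤ n
#cycles≤n {n} σ = subst (#cycles σ ≤_) (length-tabulate id) (length-deduplicate (sameCycle? σ) (allFin n))

-- The usual sign, since a cycle of length l is a product of l - 1 transpositions. On vectors that
-- are not permutations the value carries no meaning; the indicators in the sums below remove it.
sgn : Vec (Fin n) n → ℤ
sgn {n} σ = -1ℤ ^ (n ∸ #cycles σ)

sgn-merge : (σ τ : Vec (Fin n) n) → #cycles σ ≡ suc (#cycles τ) → sgn τ ≡ - sgn σ
sgn-merge {n} σ τ eq = trans (cong (-1ℤ ^_) (begin
    -- The truncated subtraction is exact here: `suc (#cycles τ)` is the number of cycles of σ,
    -- hence at most n.
    n ∸ #cycles τ              ≡⟨ ℕ.+-∸-assoc 1 (subst (_≤ n) eq (#cycles≤n σ)) ⟩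
    suc (n ∸ suc (#cycles τ))  ≡⟨ cong (λ k → suc (n ∸ k)) eq ⟨
    suc (n ∸ #cycles σ)        ∎))
  (-1*i≡-i (sgn σ))
  where open ≡-Reasoning

sgn-swapValues : {u v : Fin n} (σ : Vec (Fin n) n) → Injective _≡_ _≡_ (lookup σ) → u ≢ v →
                 sgn (swapValues u v σ) ≡ - sgn σ
sgn-swapValues {u = u} {v} σ inj u≢v with swapValues-sameCycle σ inj u≢v
... | inj₂ (u≁v , u~v) = sgn-merge σ (swapValues u v σ) (#cycles-merge σ inj u≁v u~v)
-- Here the transposition splits a cycle of σ. Swapping once more turns τ back into σ, so the
-- merging case applies to τ.
... | inj₁ (u~v , u≁v) = trans (sym (neg-involutive (sgn τ))) (cong -_ (sym (sgn-merge τ σ (begin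
  #cycles τ                            ≡⟨ #cycles-merge τ (swapValues-injective u v σ inj) u≁v
                                            (subst (λ ρ → SameCycle ρ u v) (sym ττ≡σ) u~v) ⟩
  suc (#cycles (swapValues u v τ))     ≡⟨ cong (suc ∘ #cycles) ττ≡σ ⟩
  suc (#cycles σ)                      ∎))))
  where
  open ≡-Reasoning
  τ = swapValues u v σ
  ττ≡σ = swapValues-involutive u v σ

-- All 2^n colourings with two colours are invariant under the identity.
#cycles-identity : ∀ n → #cycles (Vec.allFin n) ≡ n
#cycles-identity n = 2^-injective (begin
  (+ 2) ^ #cycles (Vec.allFin n)                     ≡⟨ ∑-invariant (Vec.allFin n) injective ⟨
  ∑[ c ← allVecs 2 n ] 𝟙 (invariant? (Vec.allFin n) c)  ≡⟨ ∑-cong (allVecs 2 n) (λ c →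
     𝟙-yes (invariant? (Vec.allFin n) c) (λ i → cong (lookup c) (lookup-allFin i))) ⟩
  ∑[ c ← allVecs 2 n ] 1ℤ                            ≡⟨ ∑-allVecs-one n ⟩
  (+ 2) ^ n ∎)
  where
  open ≡-Reasoning
  injective : Injective _≡_ _≡_ (lookup (Vec.allFin n))
  injective {i} {j} eq = trans (sym (lookup-allFin i)) (trans eq (lookup-allFin j))

  ∑-allVecs-one : ∀ n → ∑[ c ← allVecs 2 n ] 1ℤ ≡ (+ 2) ^ n
  ∑-allVecs-one zero    = refl
  ∑-allVecs-one (suc n) = trans (∑-allVecs-suc {2} {n} (λ _ → 1ℤ)) (trans
    (cong (λ s → s + (s + 0ℤ)) (∑-allVecs-one n)) (two ((+ 2) ^ n)))
    where
    two : ∀ s → s + (s + 0ℤ) ≡ (+ 2) * s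
    two = solve-∀

sgn-identity : ∀ n → sgn (Vec.allFin n) ≡ 1ℤ
sgn-identity n = cong (-1ℤ ^_) (trans (cong (n ∸_) (#cycles-identity n)) (ℕ.n∸n≡0 n))

-- D-permutations preserving a colouring

lookup-injective : ∀ {xs : List A} → AllPairs _≢_ xs → Injective _≡_ _≡_ (List.lookup xs)
lookup-injective (x≢ ∷ xs≢) {zero}  {zero}  _  = refl
lookup-injective (x≢ ∷ xs≢) {zero}  {suc j} eq = contradiction eq (All.lookup x≢ (∈-lookup j))
lookup-injective (x≢ ∷ xs≢) {suc i} {zero}  eq = contradiction (sym eq) (All.lookup x≢ (∈-lookup i))
lookup-injective (x≢ ∷ xs≢) {suc i} {suc j} eq = cong suc (lookup-injective xs≢ eq)

element-injective : (A : FiniteSubset) → Injective _≡_ _≡_ (element A)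
element-injective A =
  lookup-injective (AllPairs.map ℕ.<⇒≢ (Linked⇒AllPairs ℕ.<-trans (increasing A)))

∸-shrinkʳ : ∀ {a b c} → a < b → b < c → b ∸ a < c ∸ a
∸-shrinkʳ a<b b<c = ℕ.∸-monoˡ-< b<c (ℕ.<⇒≤ a<b)

∸-shrinkˡ : ∀ {a b c} → a < b → b < c → c ∸ b < c ∸ a
∸-shrinkˡ a<b b<c = ℕ.∸-monoʳ-< a<b (ℕ.<⇒≤ b<c)

module _ (A : FiniteSubset) {t : ℕ} (c : Vec (Fin t) (card A)) where

  private
    e : Fin (card A) → ℕ
    e = element A

  Conflict : Fin (card A) → Fin (card A) → Set
  Conflict u v = OddBelowEven (e u) (e v) × lookup c u ≡ lookup c v

  conflict? : B.Decidable Conflict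
  conflict? u v = oddBelowEven? (e u) (e v) ×-dec (lookup c u ≟ lookup c v)

  NoneBetween : Fin (card A) → Fin (card A) → Set
  NoneBetween u v = ∀ w → e u < e w → e w < e v → lookup c w ≢ lookup c u

  -- An element w of the same colour strictly between u and v conflicts with u if it is even and
  -- with v if it is odd, so it can replace the endpoint of its own parity. The gap shrinks, and `d`
  -- bounds it to make the recursion structural.
  closestConflict : ∀ d {u v} → e v ∸ e u < d → Conflict u v → ∃[ u ] ∃[ v ] Conflict u v × NoneBetween u v
  closestConflict (suc d) {u} {v} (s≤s v∸u≤d) uv@((u<v , odd-u , even-v) , cu≡cv)
    with any? (λ w → (e u ℕ.<? e w) ×-dec (e w ℕ.<? e v) ×-dec (lookup c w ≟ lookup c u))
  ... | no  none = u , v , uv , λ w u<w w<v eq → none (w , u<w , w<v , eq)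
  ... | yes (w , u<w , w<v , cw≡cu) with even? (e w)
  ...   | yes even-w = closestConflict d (ℕ.<-≤-trans (∸-shrinkʳ u<w w<v) v∸u≤d)
                         ((u<w , odd-u , even-w) , sym cw≡cu)
  ...   | no  odd-w  = closestConflict d (ℕ.<-≤-trans (∸-shrinkˡ u<w w<v) v∸u≤d)
                         ((w<v , odd-w , even-v) , trans cw≡cu cu≡cv)

  Admissible : Vec (Fin (card A)) (card A) → Set
  Admissible σ = IsDPermutation A σ × Invariant σ c

  admissible? : U.Decidable Admissible
  admissible? σ = isDPermutation? A σ ×-dec invariant? σ c

  signedCount : ℤ
  signedCount = ∑[ σ ← allVecs (card A) (card A) ] (𝟙 (admissible? σ) * sgn σ)

  module _ {u v : Fin (card A)} (conflict : Conflict u v) (none : NoneBetween u v) where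

    private
      u<v    = proj₁ (proj₁ conflict)
      odd-u  = proj₁ (proj₂ (proj₁ conflict))
      even-v = proj₂ (proj₂ (proj₁ conflict))
      cu≡cv  = proj₂ conflict

      u≢v : u ≢ v
      u≢v refl = ℕ.<-irrefl refl u<v

      odd≢even : ∀ {a b} → Odd a → Even b → a ≢ b
      odd≢even odd even refl = odd even

    -- Only a value v lowered to u at an odd i, or a value u raised to v at an even i, could break
    -- the inequalities. Then i has the colour of u and v and, by parity, differs from the old
    -- value; a violation would place i strictly between u and v, against `none`.
    swapValues-admissible : ∀ σ → Admissible σ → Admissible (swapValues u v σ)
    swapValues-admissible σ (mkIsDPermutation (inj , surj) onOdd onEven , inv) =
      mkIsDPermutation (swapValues-injective u v σ inj , strictlySurjective⇒surjective surj′)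
        (λ i odd → subst (λ j → e i ≤ e j) (sym (lookup-swapValues u v σ i))
          -- `k` is the old value at i and `l` the new one. The colour of `k` is kept as a premise
          -- so that it is known in the two cases where `k` is u or v.
          (transpose-elim u v (λ k l → lookup c k ≡ lookup c i → e i ≤ e k → e i ≤ e l)
            (λ _ i≤u → ℕ.≤-trans i≤u (ℕ.<⇒≤ u<v))
            (λ cv≡ci i≤v → ℕ.≮⇒≥ λ u<i →
              none i u<i (ℕ.≤∧≢⇒< i≤v (odd≢even odd even-v)) (trans (sym cv≡ci) (sym cu≡cv)))
            (λ _ _ _ _ → id)
            (lookup σ i) (inv i) (onOdd i odd)))
        (λ i even → subst (λ j → e j ≤ e i) (sym (lookup-swapValues u v σ i))
          (transpose-elim u v (λ k l → lookup c k ≡ lookup c i → e k ≤ e i → e l ≤ e i)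
            (λ cu≡ci u≤i → ℕ.≮⇒≥ λ i<v →
              none i (ℕ.≤∧≢⇒< u≤i (odd≢even odd-u even)) i<v (sym cu≡ci))
            (λ _ v≤i → ℕ.≤-trans (ℕ.<⇒≤ u<v) v≤i)
            (λ _ _ _ _ → id)
            (lookup σ i) (inv i) (onEven i even)))
      , λ i → trans (cong (lookup c) (lookup-swapValues u v σ i))
          (trans (transpose-elim u v (λ k l → lookup c l ≡ lookup c k)
                   (sym cu≡cv) cu≡cv (λ _ _ _ → refl) (lookup σ i))
                 (inv i))
      where
      surj′ : ∀ y → ∃[ x ] lookup (swapValues u v σ) x ≡ y
      surj′ y with surj (transpose u v y)
      ... | x , hit = x , trans (lookup-swapValues u v σ x)
        (trans (cong (transpose u v) (hit refl)) (transpose-involutive u v y))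

    -- Reindexing shows the whole sum to equal its own negative, so the cancelling terms need not be
    -- paired explicitly.
    signedCount-conflict : signedCount ≡ 0ℤ
    signedCount-conflict = i≡-i⇒i≡0 signedCount (begin
      signedCount                     ≡⟨ ∑-involution (≡-dec _≟_) σs allVecs-enumerates (swapValues u v)
                                           (swapValues-involutive u v) weight ⟨
      ∑ σs (weight ∘ swapValues u v)  ≡⟨ ∑-cong σs reverses ⟩
      ∑[ σ ← σs ] (- weight σ)        ≡⟨ ∑-neg σs weight ⟩
      - signedCount                   ∎)
      where
      open ≡-Reasoning
      σs = allVecs (card A) (card A)

      weight : Vec (Fin (card A)) (card A) → ℤ
      weight σ = 𝟙 (admissible? σ) * sgn σ

      i≡-i⇒i≡0 : ∀ i → i ≡ - i → i ≡ 0ℤ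
      i≡-i⇒i≡0 (+ zero)    _  = refl
      i≡-i⇒i≡0 (+ (suc _)) ()

      admissible-swap : ∀ σ → 𝟙 (admissible? (swapValues u v σ)) ≡ 𝟙 (admissible? σ)
      admissible-swap σ = 𝟙-cong (admissible? (swapValues u v σ)) (admissible? σ)
        (subst Admissible (swapValues-involutive u v σ) ∘ swapValues-admissible (swapValues u v σ))
        (swapValues-admissible σ)

      flipped : ∀ σ → (a? : Dec (Admissible σ)) → 𝟙 a? * sgn (swapValues u v σ) ≡ - (𝟙 a? * sgn σ)
      flipped σ (yes (d , _)) = trans
        (cong (_*_ 1ℤ) (sgn-swapValues σ (proj₁ (IsDPermutation.isPermutation d)) u≢v))
        (sym (neg-distribʳ-* 1ℤ (sgn σ)))
      flipped σ (no _) = refl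

      reverses : ∀ σ → weight (swapValues u v σ) ≡ - weight σ
      reverses σ = trans (cong (_* sgn (swapValues u v σ)) (admissible-swap σ)) (flipped σ (admissible? σ))

  module _ (proper : ProperColouring (Γ A) c) where

    private
      identity : Vec (Fin (card A)) (card A)
      identity = Vec.allFin (card A)

    -- σ moves the elements of P weakly in one direction, so it cannot return to i after moving it.
    monotone⇒fixed : (σ : Vec (Fin (card A)) (card A)) → Injective _≡_ _≡_ (lookup σ) →
      (_⊑_ : Rel ℕ 0ℓ) → B.Reflexive _⊑_ → B.Transitive _⊑_ → B.Antisymmetric _≡_ _⊑_ →
      (P : Fin (card A) → Set) → (∀ j → P j → e j ⊑ e (lookup σ j) × P (lookup σ j)) →
      ∀ i → P i → lookup σ i ≡ i
    monotone⇒fixed σ inj _⊑_ ⊑-refl ⊑-trans ⊑-antisym P step i pi with periodic inj i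
    ... | p , period = element-injective A (⊑-antisym
      (subst (λ j → e (lookup σ i) ⊑ e j) (trans (fold-comm (lookup σ) i p) period)
        (proj₁ (along (lookup σ i) (proj₂ (step i pi)) p)))
      (proj₁ (step i pi)))
      where
      along : ∀ j → P j → ∀ k → e j ⊑ e (fold j (lookup σ) k) × P (fold j (lookup σ) k)
      along j pj zero    = ⊑-refl , pj
      along j pj (suc k) with along j pj k
      ... | le , pk = ⊑-trans le (proj₁ (step _ pk)) , proj₂ (step _ pk)

    admissible⇒identity : ∀ σ → Admissible σ → σ ≡ identity
    admissible⇒identity σ (mkIsDPermutation (inj , _) onOdd onEven , inv) =
      trans (sym (tabulate∘lookup σ)) (tabulate-cong fixed)
      where
      stays-odd : ∀ j → Odd (e j) → Odd (e (lookup σ j))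
      stays-odd j odd even = proper j (lookup σ j)
        (inj₁ (ℕ.≤∧≢⇒< (onOdd j odd) (λ eq → odd (subst Even (sym eq) even)) , odd , even)) (sym (inv j))

      stays-even : ∀ j → Even (e j) → Even (e (lookup σ j))
      stays-even j even with even? (e (lookup σ j))
      ... | yes even′ = even′
      ... | no  odd′  = contradiction (inv j) (proper (lookup σ j) j
        (inj₁ (ℕ.≤∧≢⇒< (onEven j even) (λ eq → odd′ (subst Even (sym eq) even)) , odd′ , even)))

      fixed : ∀ i → lookup σ i ≡ i
      fixed i with even? (e i)
      ... | yes even = monotone⇒fixed σ inj (flip _≤_) ℕ.≤-refl (flip ℕ.≤-trans) (flip ℕ.≤-antisym)
                         (Even ∘ e) (λ j even → onEven j even , stays-even j even) i even
      ... | no  odd  = monotone⇒fixed σ inj _≤_ ℕ.≤-refl ℕ.≤-trans ℕ.≤-antisym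
                         (Odd ∘ e) (λ j odd → onOdd j odd , stays-odd j odd) i odd

    identity-admissible : Admissible identity
    identity-admissible =
      mkIsDPermutation
        ( (λ {i} {j} eq → trans (sym (lookup-allFin i)) (trans eq (lookup-allFin j)))
        , strictlySurjective⇒surjective (λ i → i , lookup-allFin i) )
        (λ i _ → ℕ.≤-reflexive (cong e (sym (lookup-allFin i))))
        (λ i _ → ℕ.≤-reflexive (cong e (lookup-allFin i)))
      , λ i → cong (lookup c) (lookup-allFin i)

    signedCount-proper : signedCount ≡ 1ℤ
    signedCount-proper = begin
      signedCount
        ≡⟨ ∑-cong σs (λ σ → cong (_* sgn σ) (𝟙-cong (admissible? σ) (≡-dec _≟_ σ identity)
             (admissible⇒identity σ) (λ { refl → identity-admissible }))) ⟩
      ∑[ σ ← σs ] (𝟙 (≡-dec _≟_ σ identity) * sgn σ)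
        ≡⟨ ∑-pick (≡-dec _≟_) σs allVecs-enumerates identity sgn ⟩
      sgn identity
        ≡⟨ sgn-identity (card A) ⟩
      1ℤ ∎
      where
      open ≡-Reasoning
      σs = allVecs (card A) (card A)

  signedCount≡proper : signedCount ≡ 𝟙 (properColouring? (Γ A) c)
  signedCount≡proper with any? (λ u → any? (conflict? u))
  ... | yes (u , v , uv) with closestConflict (suc (e v ∸ e u)) ℕ.≤-refl uv
  ...   | u′ , v′ , uv′ , none = trans (signedCount-conflict uv′ none)
    (sym (𝟙-no (properColouring? (Γ A) c) λ proper → proper u v (inj₁ (proj₁ uv)) (proj₂ uv)))
  signedCount≡proper | no harmless = trans (signedCount-proper proper)
    (sym (𝟙-yes (properColouring? (Γ A) c) proper))
    where
    proper : ProperColouring (Γ A) c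
    proper i j (inj₁ ij) eq = harmless (i , j , ij , eq)
    proper i j (inj₂ ji) eq = harmless (j , i , ji , sym eq)

-- Assembly of the chromatic polynomial

-- The factor `a` collects the powers of x that Horner evaluation pulls out, as the induction
-- requires. Taking a = x later makes the exponents start at 1.
eval-applyUpTo : ∀ a x (f : ℕ → ℤ) n →
  a * eval (applyUpTo f n) x ≡ ∑[ k ← allFin n ] (f (toℕ k) * (a * x ^ toℕ k))
eval-applyUpTo a x f zero    = *-zeroʳ a
eval-applyUpTo a x f (suc n) = begin
  a * (f 0 + x * rest)
    ≡⟨ expand a (f 0) x rest ⟩
  f 0 * (a * 1ℤ) + a * x * rest
    ≡⟨ +-congˡ (f 0 * (a * 1ℤ)) (eval-applyUpTo (a * x) x (f ∘ suc) n) ⟩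
  f 0 * (a * 1ℤ) + ∑[ k ← allFin n ] (f (suc (toℕ k)) * (a * x * x ^ toℕ k))
    ≡⟨ +-congˡ (f 0 * (a * 1ℤ)) (∑-cong (allFin n) λ k →
         cong (_*_ (f (suc (toℕ k)))) (*-assoc a x (x ^ toℕ k))) ⟩
  f 0 * (a * 1ℤ) + ∑[ k ← allFin n ] (f (suc (toℕ k)) * (a * (x * x ^ toℕ k)))
    ≡⟨ ∑-allFin-suc {n} (λ k → f (toℕ k) * (a * x ^ toℕ k)) ⟨
  ∑[ k ← allFin (suc n) ] (f (toℕ k) * (a * x ^ toℕ k)) ∎
  where
  open ≡-Reasoning
  rest = eval (applyUpTo (f ∘ suc) n) x
  expand : ∀ a b x r → a * (b + x * r) ≡ b * (a * 1ℤ) + a * x * r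
  expand = solve-∀

-- The index k stands for the exponent k + 1, so the exponents covered are exactly 1 to n and the
-- term picked out has index m - 1.
∑-pick-suc : ∀ {n} m → 1 ≤ m → m ≤ n → (h : ℕ → ℤ) →
             ∑[ k ← allFin n ] (𝟙 (m ℕ.≟ suc (toℕ k)) * h (suc (toℕ k))) ≡ h m
∑-pick-suc {n} (suc m) _ m<n h = begin
  ∑[ k ← allFin n ] (𝟙 (suc m ℕ.≟ suc (toℕ k)) * h (suc (toℕ k)))
    ≡⟨ ∑-cong (allFin n) (λ k → cong (_* h (suc (toℕ k)))
         (𝟙-cong (suc m ℕ.≟ suc (toℕ k)) (k ≟ j)
           (λ eq → toℕ-injective (trans (sym (ℕ.suc-injective eq)) (sym (toℕ-fromℕ< m<n))))
           (λ { refl → cong suc (sym (toℕ-fromℕ< m<n)) }))) ⟩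
  ∑[ k ← allFin n ] (𝟙 (k ≟ j) * h (suc (toℕ k)))
    ≡⟨ ∑-pick _≟_ (allFin n) allFin-enumerates j (h ∘ suc ∘ toℕ) ⟩
  h (suc (toℕ j))
    ≡⟨ cong (h ∘ suc) (toℕ-fromℕ< m<n) ⟩
  h (suc m) ∎
  where
  open ≡-Reasoning
  j = fromℕ< m<n

-- The first position is always kept as a representative. The bound matters because the polynomial
-- has constant coefficient 0 and would miss a permutation without cycles.
1≤#cycles : 1 ≤ n → (σ : Vec (Fin n) n) → 1 ≤ #cycles σ
1≤#cycles {suc n} _ σ = s≤s z≤n

-1^k*-1^k : ∀ k x → -1ℤ ^ k * (-1ℤ ^ k * x) ≡ x
-1^k*-1^k zero    x = trans (*-identityˡ (1ℤ * x)) (*-identityˡ x)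
-1^k*-1^k (suc k) x = trans (signs (-1ℤ ^ k) x) (-1^k*-1^k k x)
  where
  signs : ∀ s x → -1ℤ * s * (-1ℤ * s * x) ≡ s * (s * x)
  signs = solve-∀

module _ (A : FiniteSubset) where

  private
    σs = allVecs (card A) (card A)

  signedNumber : ℕ → ℤ
  signedNumber k = -1ℤ ^ (card A ∸ k) * + #DPermutations A k

  -- After the sums over k and σ are exchanged, each σ contributes only at k = `#cycles σ`, where
  -- the sign of the coefficient is `sgn σ`.
  eval-signedNumber : 1 ≤ card A → ∀ x →
    eval (Σ[1⋯ card A ] signedNumber) x ≡ ∑[ σ ← σs ] (𝟙 (isDPermutation? A σ) * (sgn σ * x ^ #cycles σ))
  eval-signedNumber 1≤n x = begin
    0ℤ + x * eval (applyUpTo (signedNumber ∘ suc) (card A)) x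
      ≡⟨ +-identityˡ _ ⟩
    x * eval (applyUpTo (signedNumber ∘ suc) (card A)) x
      ≡⟨ eval-applyUpTo x x (signedNumber ∘ suc) (card A) ⟩
    ∑[ k ← allFin (card A) ] (signedNumber (suc (toℕ k)) * x ^ suc (toℕ k))
      ≡⟨ ∑-cong (allFin (card A)) (λ k → expand (suc (toℕ k))) ⟩
    ∑[ k ← allFin (card A) ] ∑[ σ ← σs ] (D σ * (𝟙 (#cycles σ ℕ.≟ suc (toℕ k)) * term (suc (toℕ k))))
      ≡⟨ ∑-swap (allFin (card A)) σs (λ k σ → D σ * (𝟙 (#cycles σ ℕ.≟ suc (toℕ k)) * term (suc (toℕ k)))) ⟩
    ∑[ σ ← σs ] ∑[ k ← allFin (card A) ] (D σ * (𝟙 (#cycles σ ℕ.≟ suc (toℕ k)) * term (suc (toℕ k))))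
      ≡⟨ ∑-cong σs (λ σ → trans
           (sym (∑-*ˡ (D σ) (allFin (card A)) (λ k → 𝟙 (#cycles σ ℕ.≟ suc (toℕ k)) * term (suc (toℕ k)))))
           (cong (_*_ (D σ)) (∑-pick-suc (#cycles σ) (1≤#cycles 1≤n σ) (#cycles≤n σ) term))) ⟩
    ∑[ σ ← σs ] (D σ * (sgn σ * x ^ #cycles σ)) ∎
    where
    open ≡-Reasoning
    D : Vec (Fin (card A)) (card A) → ℤ
    D σ = 𝟙 (isDPermutation? A σ)

    term : ℕ → ℤ
    term k = -1ℤ ^ (card A ∸ k) * x ^ k

    counted? : ∀ k → U.Decidable (λ σ → IsDPermutation A σ × #cycles σ ≡ k)
    counted? k σ = isDPermutation? A σ ×-dec (#cycles σ ℕ.≟ k)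

    expand : ∀ k → signedNumber k * x ^ k ≡ ∑[ σ ← σs ] (D σ * (𝟙 (#cycles σ ℕ.≟ k) * term k))
    expand k = begin
      -1ℤ ^ (card A ∸ k) * + #DPermutations A k * x ^ k
        ≡⟨ shuffle (-1ℤ ^ (card A ∸ k)) (+ #DPermutations A k) (x ^ k) ⟩
      + #DPermutations A k * term k
        ≡⟨ cong (_* term k) (length-filter≡∑ (counted? k) σs) ⟩
      (∑[ σ ← σs ] 𝟙 (counted? k σ)) * term k
        ≡⟨ ∑-*ʳ (term k) σs (λ σ → 𝟙 (counted? k σ)) ⟩
      ∑[ σ ← σs ] (𝟙 (counted? k σ) * term k)
        ≡⟨ ∑-cong σs (λ σ → trans
             (cong (_* term k) (𝟙-× (isDPermutation? A σ) (#cycles σ ℕ.≟ k)))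
             (*-assoc (D σ) (𝟙 (#cycles σ ℕ.≟ k)) (term k))) ⟩
      ∑[ σ ← σs ] (D σ * (𝟙 (#cycles σ ℕ.≟ k) * term k)) ∎
      where
      shuffle : ∀ a b c → a * b * c ≡ b * (a * c)
      shuffle = solve-∀

  ∑-signedCount : ∀ t → ∑[ σ ← σs ] (𝟙 (isDPermutation? A σ) * (sgn σ * (+ t) ^ #cycles σ))
                      ≡ ∑[ c ← allVecs t (card A) ] signedCount A c
  ∑-signedCount t = trans (∑-cong σs λ σ → colour σ (isDPermutation? A σ)) (∑-swap σs cs weight)
    where
    open ≡-Reasoning
    cs = allVecs t (card A)

    weight : Vec (Fin (card A)) (card A) → Vec (Fin t) (card A) → ℤ
    weight σ c = 𝟙 (admissible? A c σ) * sgn σ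

    colour : ∀ σ (d? : Dec (IsDPermutation A σ)) →
      𝟙 d? * (sgn σ * (+ t) ^ #cycles σ) ≡ ∑[ c ← cs ] (𝟙 (d? ×-dec invariant? σ c) * sgn σ)
    colour σ (no _)  = sym (∑-zero cs)
    colour σ (yes d) = begin
      1ℤ * (sgn σ * (+ t) ^ #cycles σ)               ≡⟨ *-identityˡ _ ⟩
      sgn σ * (+ t) ^ #cycles σ                      ≡⟨ *-comm (sgn σ) ((+ t) ^ #cycles σ) ⟩
      (+ t) ^ #cycles σ * sgn σ                      ≡⟨ cong (_* sgn σ) (∑-invariant σ injective) ⟨
      (∑[ c ← cs ] 𝟙 (invariant? σ c)) * sgn σ       ≡⟨ ∑-*ʳ (sgn σ) cs (λ c → 𝟙 (invariant? σ c)) ⟩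
      ∑[ c ← cs ] (𝟙 (invariant? σ c) * sgn σ)       ∎
      where
      injective = proj₁ (IsDPermutation.isPermutation d)

-- The sign is (-1)^(|A| - k): for a singleton the polynomial is t and there is one D-permutation,
-- with one cycle, so (-1)^k would be wrong. `A` is nonempty because the empty graph has one
-- colouring while the empty sum is 0.
corollary4p10 : (A : FiniteSubset) → 1 ≤ card A →
    Σ[ sD ∈ (ℕ → ℤ) ]
    IsChromaticPolynomial (Γ A) (Σ[1⋯ card A ] sD)
    × (∀ k → 1 ≤ k → k ≤ card A →
    -1ℤ ^ (card A ∸ k) * sD k ≡ + #DPermutations A k)
corollary4p10 A 1≤n = signedNumber A , chromatic , λ k _ _ → -1^k*-1^k (card A ∸ k) (+ #DPermutations A k)
  where
  open ≡-Reasoning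
  chromatic : IsChromaticPolynomial (Γ A) (Σ[1⋯ card A ] (signedNumber A))
  chromatic t = begin
    eval (Σ[1⋯ card A ] (signedNumber A)) (+ t)
      ≡⟨ eval-signedNumber A 1≤n (+ t) ⟩
    ∑[ σ ← allVecs (card A) (card A) ] (𝟙 (isDPermutation? A σ) * (sgn σ * (+ t) ^ #cycles σ))
      ≡⟨ ∑-signedCount A t ⟩
    ∑[ c ← allVecs t (card A) ] signedCount A c
      ≡⟨ ∑-cong (allVecs t (card A)) (signedCount≡proper A) ⟩
    ∑[ c ← allVecs t (card A) ] 𝟙 (properColouring? (Γ A) c)
      ≡⟨ length-filter≡∑ (properColouring? (Γ A)) (allVecs t (card A)) ⟨
    + #properColourings (Γ A) t ∎
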